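{- Let $p$ be a prime with $p\leq 73$ and let $q=p^{3}$. Then the projective plane $PG(2,q)$ contains a $2$-fold blocking set of size $2\left(q+\sqrt[3]{q^{2}}+\sqrt[3]{q}+1\right)$.
   Context: A $2$-fold blocking set in $PG(2,q)$ is a set of points meeting every line of $PG(2,q)$ in at least $2$ points. -}

module Defs where

open import Level using (Level; _⊔_)
open import Data.Nat using (ℕ)
open import Data.Fin using (Fin)
open import Data.Product using (Σ; _×_; _,_; ∃)
open import Data.Vec.Functional using (Vector)
open import Relation.Nullary using (¬_)
open import Relation.Binary.PropositionalEquality using (_≡_)
open import Algebra.Bundles using (CommutativeRing)

record IsField {c ℓ : Level} (R : CommutativeRing c ℓ) : Set (c ⊔ ℓ) where
  open CommutativeRing R
  field
    1≉0     : ¬ (1# ≈ 0#)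
    inverse : ∀ x → ¬ (x ≈ 0#) → Σ Carrier λ y → (x * y) ≈ 1#

record HasOrder {c ℓ : Level} (R : CommutativeRing c ℓ) (n : ℕ) : Set (c ⊔ ℓ) where
  open CommutativeRing R
  field
    enum       : Fin n → Carrier
    enum-inj   : ∀ i j → enum i ≈ enum j → i ≡ j
    enum-surj  : ∀ x → Σ (Fin n) λ i → enum i ≈ x

module ProjectivePlane {c ℓ : Level} (R : CommutativeRing c ℓ) where
  open CommutativeRing R

  Triple : Set c
  Triple = Carrier × Carrier × Carrier

  NonZero : Triple → Set ℓ
  NonZero (x , y , z) = ¬ ((x ≈ 0#) × (y ≈ 0#) × (z ≈ 0#))

  Proportional : Triple → Triple → Set (c ⊔ ℓ)
  Proportional (x , y , z) (x' , y' , z') =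
    Σ Carrier λ t → ¬ (t ≈ 0#) × ((t * x) ≈ x') × ((t * y) ≈ y') × ((t * z) ≈ z')

  Incident : Triple → Triple → Set ℓ
  Incident (x , y , z) (a , b , c) = ((a * x) + (b * y) + (c * z)) ≈ 0#

  record PointSet (k : ℕ) : Set (c ⊔ ℓ) where
    field
      pt        : Vector Triple k
      nonzero   : ∀ i → NonZero (pt i)
      distinct  : ∀ i j → Proportional (pt i) (pt j) → i ≡ j

  -- A t-fold blocking set for t = 2: every line (given by nonzero coordinates
  -- [a,b,c]) contains at least 2 of the points, i.e. two points with distinct
  -- indices (hence distinct projective points).
  Is2FoldBlocking : ∀ {k} → PointSet k → Set (c ⊔ ℓ)
  Is2FoldBlocking {k} B = ∀ L → NonZero L →
    Σ (Fin k) λ i → Σ (Fin k) λ j →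
      ¬ (i ≡ j) × Incident (PointSet.pt B i) L × Incident (PointSet.pt B j) L

{-# OPTIONS --safe #-}
-- Let P be the prime field of F = GF(p³), and let m : F → P be a nonzero P-linear map.  The points
-- (x : m x : a) with x ∈ F and a ∈ P form a blocking set: for a line [A, B, C], the additive map
-- x ↦ A x + B m x is either onto, hence takes the value −C, or has a nontrivial kernel.  Normalised
-- by a = 1, by a = 0 and m x = 1, or by a = m x = 0, it has at most p³ + p² + 1 points.
--
-- A disjoint partner is found among the sets {(b : y : ℓ y + b σ) : y ∈ F, b ∈ P}.  Fix s ∉ P and take
-- ℓ with ℓ 1 = 0 and ℓ s = 1, and σ = s + μ with μ ∈ P.  A common point would give T ∈ P with
-- T − m (1 / (T + s)) = μ.  If m (1 / s) = 0 and m (1 / (1 + s)) = 1, then T ↦ T − m (1 / (T + s))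
-- vanishes at both 0 and 1, so on the finite set P it misses some value, and that is the choice of μ.
-- Finally, the union of the two sets is enlarged to the required size by arbitrary further points.
module Submission where

open import Defs
open import Level using (Level; _⊔_)
open import Algebra.Bundles using (CommutativeRing)
open import Data.Fin.Base as Fin using (Fin; zero; suc; punchIn; punchOut; toℕ; finToFun; funToFin)
open import Data.Fin.Patterns using (0F; 1F; 2F)
open import Data.Fin.Permutation using (permutation)
open import Data.Fin.Properties using
  ( any?; ¬∀⟶∃¬; injective⇒≤; pigeonhole; punchIn-punchOut; toℕ<n; toℕ-injective; toℕ-fromℕ<
  ; combine-remQuot; finToFun-funToFin; funToFin-finToFin)
  renaming (_≟_ to _≟ᶠ_; <⇒≢ to <ᶠ⇒≢)
open import Data.List.Base using (List; []; _∷_; _++_; length; tabulate)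
open import Data.List.Membership.Propositional using (_∈_)
open import Data.List.Membership.Propositional.Properties using (∈-++⁺ˡ; ∈-++⁺ʳ; ∈-tabulate⁺)
open import Data.List.Properties using (length-++; length-tabulate)
open import Data.List.Relation.Unary.All as All using (All; []; _∷_)
open import Data.List.Relation.Unary.All.Properties using (++⁺; tabulate⁺)
open import Data.List.Relation.Unary.Any using (here; there)
open import Data.Nat.Base as ℕ using (ℕ; zero; suc; _^_; _≤_; _<_; s≤s; z≤n)
open import Data.Nat.Coprimality using (prime⇒coprime; coprime-Bézout)
open import Data.Nat.DivMod using (_%_; _/_; m≡m%n+[m/n]*n; m%n<n)
open import Data.Nat.GCD using (module Bézout)
open import Data.Nat.Primality using (Prime; prime⇒nonZero; prime⇒nonTrivial)
import Data.Nat.Properties as ℕ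
open import Data.Product.Base using (Σ; ∃; ∃₂; _×_; _,_; proj₁; proj₂)
open import Data.Sum.Base using (_⊎_; inj₁; inj₂; [_,_]′; map₂)
open import Function.Base using (_∘_)
open import Relation.Binary.Definitions using (Decidable)
open import Relation.Binary.PropositionalEquality as ≡ using (_≡_; _≢_)
open import Relation.Nullary using (¬_; Dec; yes; no; contradiction)
open import Relation.Nullary.Decidable using (map′; decidable-stable; ¬?; _×-dec_)

-- A ring solver with integer coefficients.

module IntegerSolver {c ℓ} (R : CommutativeRing c ℓ) where
  open CommutativeRing R
  open import Algebra.Properties.AbelianGroup +-abelianGroup
    using () renaming (ε⁻¹≈ε to -0≈0; ⁻¹-involutive to -‿involutive; ⁻¹-∙-comm to -‿+-comm)
  open import Algebra.Properties.CommutativeSemigroup +-commutativeSemigroup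
    using (interchange)
  open import Algebra.Properties.Ring ring using (-‿distribˡ-*; -‿distribʳ-*)
  open import Algebra.Properties.Semiring.Mult.TCOptimised semiring
    using (×-homo-+; ×1-homo-*; 1+×) renaming (_×_ to _·_)
  open import Algebra.Solver.Ring.AlmostCommutativeRing
    using (fromCommutativeRing; _-Raw-AlmostCommutative⟶_)
  open import Data.Integer.Base as ℤ using (ℤ; +_; -[1+_]; _⊖_; _◃_)
  open import Data.Integer.Properties using (+◃n≡+n; [1+m]⊖[1+n]≡m⊖n; _≟_)
  open import Data.Maybe.Base using (map)
  import Data.Sign.Base as Sign
  open import Relation.Binary.Consequences using (dec⇒weaklyDec)
  open import Relation.Binary.Reasoning.Setoid setoid

  private
    ⟦_⟧ℤ : ℤ → Carrier
    ⟦ + n ⟧ℤ      = n · 1#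
    ⟦ -[1+ n ] ⟧ℤ = - (suc n · 1#)

    ⟦⟧-≡ : ∀ {i j} → i ≡ j → ⟦ i ⟧ℤ ≈ ⟦ j ⟧ℤ
    ⟦⟧-≡ ≡.refl = refl

    ⊖-homo : ∀ m n → ⟦ m ⊖ n ⟧ℤ ≈ m · 1# - n · 1#
    ⊖-homo m       zero    = sym (trans (+-congˡ -0≈0) (+-identityʳ _))
    ⊖-homo zero    (suc n) = sym (+-identityˡ _)
    ⊖-homo (suc m) (suc n) = begin
      ⟦ suc m ⊖ suc n ⟧ℤ                  ≈⟨ ⟦⟧-≡ ([1+m]⊖[1+n]≡m⊖n m n) ⟩
      ⟦ m ⊖ n ⟧ℤ                          ≈⟨ ⊖-homo m n ⟩
      m · 1# - n · 1#                     ≈⟨ +-identityˡ _ ⟨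
      0# + (m · 1# - n · 1#)              ≈⟨ +-congʳ (-‿inverseʳ 1#) ⟨
      (1# - 1#) + (m · 1# - n · 1#)       ≈⟨ interchange _ _ _ _ ⟩
      (1# + m · 1#) + (- 1# - n · 1#)     ≈⟨ +-congˡ (-‿+-comm _ _) ⟩
      (1# + m · 1#) - (1# + n · 1#)       ≈⟨ +-cong (1+× m 1#) (-‿cong (1+× n 1#)) ⟨
      suc m · 1# - suc n · 1#             ∎

    -◃-homo : ∀ n → ⟦ Sign.- ◃ n ⟧ℤ ≈ - (n · 1#)
    -◃-homo zero    = sym -0≈0
    -◃-homo (suc n) = refl

    +-homo : ∀ i j → ⟦ i ℤ.+ j ⟧ℤ ≈ ⟦ i ⟧ℤ + ⟦ j ⟧ℤ
    +-homo (+ m)    (+ n)    = ×-homo-+ 1# m n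
    +-homo (+ m)    -[1+ n ] = ⊖-homo m (suc n)
    +-homo -[1+ m ] (+ n)    = trans (⊖-homo n (suc m)) (+-comm _ _)
    +-homo -[1+ m ] -[1+ n ] = begin
      - (suc (suc (m ℕ.+ n)) · 1#)       ≈⟨ -‿cong (1+× (suc (m ℕ.+ n)) 1#) ⟩
      - (1# + (suc m ℕ.+ n) · 1#)        ≈⟨ -‿cong (+-congˡ (×-homo-+ 1# (suc m) n)) ⟩
      - (1# + (suc m · 1# + n · 1#))     ≈⟨ -‿cong (x∙yz≈y∙xz _ _ _) ⟩
      - (suc m · 1# + (1# + n · 1#))     ≈⟨ -‿cong (+-congˡ (1+× n 1#)) ⟨
      - (suc m · 1# + suc n · 1#)        ≈⟨ -‿+-comm _ _ ⟨
      - (suc m · 1#) - (suc n · 1#)      ∎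
      where open import Algebra.Properties.CommutativeSemigroup +-commutativeSemigroup
              using (x∙yz≈y∙xz)

    *-homo : ∀ i j → ⟦ i ℤ.* j ⟧ℤ ≈ ⟦ i ⟧ℤ * ⟦ j ⟧ℤ
    *-homo (+ m) (+ n) = trans (⟦⟧-≡ (+◃n≡+n (m ℕ.* n))) (×1-homo-* m n)
    *-homo (+ m) -[1+ n ] = begin
      ⟦ Sign.- ◃ m ℕ.* suc n ⟧ℤ      ≈⟨ -◃-homo (m ℕ.* suc n) ⟩
      - ((m ℕ.* suc n) · 1#)         ≈⟨ -‿cong (×1-homo-* m (suc n)) ⟩
      - (m · 1# * suc n · 1#)        ≈⟨ -‿distribʳ-* _ _ ⟩
      m · 1# * - (suc n · 1#)        ∎
    *-homo -[1+ m ] (+ n) = begin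
      ⟦ Sign.- ◃ suc m ℕ.* n ⟧ℤ      ≈⟨ -◃-homo (suc m ℕ.* n) ⟩
      - ((suc m ℕ.* n) · 1#)         ≈⟨ -‿cong (×1-homo-* (suc m) n) ⟩
      - (suc m · 1# * n · 1#)        ≈⟨ -‿distribˡ-* _ _ ⟩
      - (suc m · 1#) * n · 1#        ∎
    *-homo -[1+ m ] -[1+ n ] = begin
      (suc m ℕ.* suc n) · 1#               ≈⟨ ×1-homo-* (suc m) (suc n) ⟩
      suc m · 1# * suc n · 1#              ≈⟨ -‿involutive _ ⟨
      - - (suc m · 1# * suc n · 1#)        ≈⟨ -‿cong (-‿distribʳ-* _ _) ⟩
      - (suc m · 1# * - (suc n · 1#))      ≈⟨ -‿distribˡ-* _ _ ⟩
      - (suc m · 1#) * - (suc n · 1#)      ∎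

    -‿homo : ∀ i → ⟦ ℤ.- i ⟧ℤ ≈ - ⟦ i ⟧ℤ
    -‿homo (+ zero)  = sym -0≈0
    -‿homo (+ suc n) = refl
    -‿homo -[1+ n ]  = sym (-‿involutive _)

    -- Integer coefficients have decidable equality, so the solver can cancel opposite terms over
    -- any commutative ring, even one whose own equality is not decidable.
    homomorphism : ℤ.+-*-rawRing -Raw-AlmostCommutative⟶ fromCommutativeRing R
    homomorphism = record
      { ⟦_⟧    = ⟦_⟧ℤ
      ; +-homo = +-homo
      ; *-homo = *-homo
      ; -‿homo = -‿homo
      ; 0-homo = refl
      ; 1-homo = refl
      }

  open import Algebra.Solver.Ring ℤ.+-*-rawRing (fromCommutativeRing R) homomorphism
    (λ i j → map ⟦⟧-≡ (dec⇒weaklyDec _≟_ i j)) public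
    using (Polynomial; solve; _:=_; con; _:+_; _:*_; _:-_; :-_)

  :0 :1 : ∀ {n} → Polynomial n
  :0 = con (+ 0)
  :1 = con (+ 1)

-- Missed values of maps between finite sets.

-- If every value were hit, a choice of preimages would be an injection from `Fin n` into the
-- smaller `Fin k`, because `f` recovers the value from its preimage.
missed-value : ∀ {k n} → k < n → (f : Fin k → Fin n) → ∃ λ j → ∀ i → f i ≢ j
missed-value {k} {n} k<n f = j , λ i fi≡j → ¬hit (i , fi≡j)
  where
  Hit : Fin n → Set
  Hit j = ∃ λ i → f i ≡ j

  not-onto : ¬ (∀ j → Hit j)
  not-onto hit = ℕ.<⇒≱ k<n (injective⇒≤ {f = proj₁ ∘ hit} λ {x} {y} eq →
    ≡.trans (≡.sym (proj₂ (hit x))) (≡.trans (≡.cong f eq) (proj₂ (hit y))))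

  missed = ¬∀⟶∃¬ n Hit (λ j → any? λ i → f i ≟ᶠ j) not-onto
  j      = proj₁ missed
  ¬hit   = proj₂ missed

-- Deleting `i` from the domain does not shrink the image, since `j` has the same value. The domain
-- is then smaller than the codomain.
non-injective⇒missed-value : ∀ {n} (f : Fin n → Fin n) {i j} → i ≢ j → f i ≡ f j →
  ∃ λ k → ∀ l → f l ≢ k
non-injective⇒missed-value {suc n} f {i} {j} i≢j fi≡fj = k , misses
  where
  k        = proj₁ (missed-value (ℕ.n<1+n n) (f ∘ punchIn i))
  k-missed = proj₂ (missed-value (ℕ.n<1+n n) (f ∘ punchIn i))

  misses-≢ : ∀ {l} → i ≢ l → f l ≢ k
  misses-≢ i≢l fl≡k =
    k-missed (punchOut i≢l) (≡.trans (≡.cong f (punchIn-punchOut i≢l)) fl≡k)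

  misses : ∀ l → f l ≢ k
  misses l fl≡k with i ≟ᶠ l
  ... | yes ≡.refl = misses-≢ i≢j (≡.trans (≡.sym fi≡fj) fl≡k)
  ... | no i≢l     = misses-≢ i≢l fl≡k

-- Finite fields: decidability, counting arguments, and the order as a multiple of 1.

module FiniteField {c ℓ} (F : CommutativeRing c ℓ) (isField : IsField F)
                   {q : ℕ} (order : HasOrder F q) where
  open CommutativeRing F
  open IsField isField
  open HasOrder order
  open IntegerSolver F
  open import Algebra.Properties.Group +-group using () renaming (x∙y⁻¹≈ε⇒x≈y to x-y≈0⇒x≈y)
  open import Algebra.Properties.Semiring.Mult semiring using () renaming (_×_ to _·_)
  open import Algebra.Properties.CommutativeMonoid.Sum +-commutativeMonoid
    using (sum; sum-cong-≋; sum-permute; ∑-distrib-+; sum-replicate)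
  open import Relation.Binary.Reasoning.Setoid setoid

  index : Carrier → Fin q
  index x = proj₁ (enum-surj x)

  enum-index : ∀ x → enum (index x) ≈ x
  enum-index x = proj₂ (enum-surj x)

  index-cong : ∀ {x y} → x ≈ y → index x ≡ index y
  index-cong x≈y = enum-inj _ _ (trans (enum-index _) (trans x≈y (sym (enum-index _))))

  index-injective : ∀ {x y} → index x ≡ index y → x ≈ y
  index-injective eq =
    trans (sym (enum-index _)) (trans (reflexive (≡.cong enum eq)) (enum-index _))

  index-enum : ∀ i → index (enum i) ≡ i
  index-enum i = enum-inj _ _ (enum-index (enum i))

  infix 4 _≟_
  _≟_ : Decidable _≈_
  x ≟ y = map′ index-injective index-cong (index x ≟ᶠ index y)

  fresh : ∀ {k} → k < q → (f : Fin k → Carrier) → ∃ λ x → ∀ i → ¬ f i ≈ x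
  fresh k<q f with missed-value k<q (index ∘ f)
  ... | j , misses = enum j , λ i fi≈ → misses i (≡.trans (index-cong fi≈) (index-enum j))

  -- Pigeonhole on the `q + 1` elements consisting of `y` and the values of `f`: the coincidence
  -- either involves `y` or lies between two values of `f`.
  hit-or-collision : (f : Fin q → Carrier) (y : Carrier) →
    (∃ λ i → f i ≈ y) ⊎ (∃₂ λ i j → i ≢ j × f i ≈ f j)
  hit-or-collision f y = split (pigeonhole (ℕ.n<1+n q) (index ∘ f+y))
    where
    f+y : Fin (suc q) → Carrier
    f+y zero    = y
    f+y (suc i) = f i

    split : (∃₂ λ i j → i Fin.< j × index (f+y i) ≡ index (f+y j)) →
            (∃ λ i → f i ≈ y) ⊎ (∃₂ λ i j → i ≢ j × f i ≈ f j)
    split (zero  , suc j , _   , eq) = inj₁ (j , sym (index-injective eq))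
    split (suc i , suc j , i<j , eq) =
      inj₂ (i , j , <ᶠ⇒≢ i<j ∘ ≡.cong suc , index-injective eq)

  -- Replaces rank and nullity by counting: two arguments with the same value differ by a nonzero
  -- element of the kernel.
  preimage-or-kernel : (φ : Carrier → Carrier) → (∀ x y → φ (x - y) ≈ φ x - φ y) →
    ∀ y → (∃ λ i → φ (enum i) ≈ y) ⊎ (∃ λ x → ¬ x ≈ 0# × φ x ≈ 0#)
  preimage-or-kernel φ φ-- y with hit-or-collision (φ ∘ enum) y
  ... | inj₁ hit                = inj₁ hit
  ... | inj₂ (i , j , i≢j , eq) = inj₂
    ( enum i - enum j
    , i≢j ∘ enum-inj i j ∘ x-y≈0⇒x≈y _ _
    , trans (φ-- _ _) (trans (+-congʳ eq) (-‿inverseʳ _)))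

  *-cancel-0 : ∀ {x y} → ¬ x ≈ 0# → x * y ≈ 0# → y ≈ 0#
  *-cancel-0 {x} {y} x≉0 xy≈0 with inverse x x≉0
  ... | x⁻¹ , xx⁻¹≈1 = begin
    y              ≈⟨ *-identityˡ y ⟨
    1# * y         ≈⟨ *-congʳ xx⁻¹≈1 ⟨
    x * x⁻¹ * y    ≈⟨ solve 3 (λ x z y → x :* z :* y := z :* (x :* y)) refl x x⁻¹ y ⟩
    x⁻¹ * (x * y)  ≈⟨ *-congˡ xy≈0 ⟩
    x⁻¹ * 0#       ≈⟨ zeroʳ x⁻¹ ⟩
    0#             ∎

  -- Translation by 1 permutes the field, so it does not change the sum of all elements.
  order×1≈0 : q · 1# ≈ 0#
  order×1≈0 = begin
    q · 1#              ≈⟨ solve 2 (λ s n → n := s :+ n :- s) refl S (q · 1#) ⟩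
    S + q · 1# - S      ≈⟨ +-congʳ S≈S+q ⟨
    S - S                ≈⟨ -‿inverseʳ S ⟩
    0#                   ∎
    where
    S = sum enum

    translation = permutation (λ i → index (enum i + 1#)) (λ i → index (enum i - 1#))
      (λ i → ≡.trans (index-cong (trans (+-congʳ (enum-index _))
        (solve 1 (λ x → x :- :1 :+ :1 := x) refl (enum i)))) (index-enum i))
      (λ i → ≡.trans (index-cong (trans (+-congʳ (enum-index _))
        (solve 1 (λ x → x :+ :1 :- :1 := x) refl (enum i)))) (index-enum i))

    S≈S+q : S ≈ S + q · 1#
    S≈S+q = begin
      S                                      ≈⟨ sum-permute enum translation ⟩
      sum (λ i → enum (index (enum i + 1#))) ≈⟨ sum-cong-≋ (λ i → enum-index (enum i + 1#)) ⟩
      sum (λ i → enum i + 1#)                ≈⟨ ∑-distrib-+ enum (λ _ → 1#) ⟩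
      S + sum {q} (λ _ → 1#)                 ≈⟨ +-congˡ (sum-replicate q) ⟩
      S + q · 1#                            ∎

-- The prime field P of a field of order p³.

module CubicExtension {c ℓ} (F : CommutativeRing c ℓ) (isField : IsField F)
                      {p : ℕ} (p-prime : Prime p) (order : HasOrder F (p ^ 3)) where
  open CommutativeRing F
  open IsField isField
  open FiniteField F isField order
  open IntegerSolver F
  open import Algebra.Properties.Group +-group
    using () renaming (x∙y⁻¹≈ε⇒x≈y to x-y≈0⇒x≈y; x≈y⇒x∙y⁻¹≈ε to x≈y⇒x-y≈0)
  open import Algebra.Properties.Ring ring using ([y-z]x≈yx-zx)
  open import Algebra.Properties.Semiring.Mult semiring
    using (×-homo-+; ×1-homo-*) renaming (_×_ to _·_)
  open import Relation.Binary.Reasoning.Setoid setoid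

  private instance
    p≢0 : ℕ.NonZero p
    p≢0 = prime⇒nonZero p-prime

  1<p : 1 < p
  1<p = ℕ.nonTrivial⇒n>1 p {{prime⇒nonTrivial p-prime}}

  -- The cube of `p · 1#` is `(p ^ 3) · 1#`, which vanishes, and a field has no zero divisors.
  p×1≈0 : p · 1# ≈ 0#
  p×1≈0 = decidable-stable (p · 1# ≟ 0#) λ p≉0 →
    -- `p ^ 3` unfolds to `p * (p * (p * 1))`. Cancelling the three factors leaves `1 · 1#`, that is
    -- `1# + 0#`.
    1≉0 (trans (sym (+-identityʳ 1#)) (*-cancel-0 p≉0 (*-cancel-0 p≉0 (*-cancel-0 p≉0 (begin
      p · 1# * (p · 1# * (p · 1# * (1 · 1#)))   ≈⟨ *-congˡ (*-congˡ (×1-homo-* p 1)) ⟨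
      p · 1# * (p · 1# * ((p ^ 1) · 1#))         ≈⟨ *-congˡ (×1-homo-* p (p ^ 1)) ⟨
      p · 1# * ((p ^ 2) · 1#)                     ≈⟨ ×1-homo-* p (p ^ 2) ⟨
      (p ^ 3) · 1#                                 ≈⟨ order×1≈0 ⟩
      0#                                            ∎)))))

  -- Membership in the prime field P.
  Scalar : Carrier → Set ℓ
  Scalar x = ∃ λ n → n · 1# ≈ x

  Scalar-resp-≈ : ∀ {x y} → x ≈ y → Scalar x → Scalar y
  Scalar-resp-≈ x≈y (n , n≈x) = n , trans n≈x x≈y

  Scalar-0 : Scalar 0#
  Scalar-0 = 0 , refl

  Scalar-1 : Scalar 1#
  Scalar-1 = 1 , +-identityʳ 1#

  Scalar-+ : ∀ {x y} → Scalar x → Scalar y → Scalar (x + y)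
  Scalar-+ (m , m≈x) (n , n≈y) = m ℕ.+ n , trans (×-homo-+ 1# m n) (+-cong m≈x n≈y)

  Scalar-* : ∀ {x y} → Scalar x → Scalar y → Scalar (x * y)
  Scalar-* (m , m≈x) (n , n≈y) = m ℕ.* n , trans (×1-homo-* m n) (*-cong m≈x n≈y)

  Scalar-neg : ∀ {x} → Scalar x → Scalar (- x)
  Scalar-neg {x} x∈P = Scalar-resp-≈ -1*x≈-x (Scalar-* -1∈P x∈P)
    where
    -1∈P : Scalar (- 1#)
    -- The multiples in `Scalar` are natural numbers, so -1 is reached as p - 1.
    -1∈P = ℕ.pred p , (begin
      ℕ.pred p · 1#              ≈⟨ solve 1 (λ n → n := :1 :+ n :- :1) refl _ ⟩
      suc (ℕ.pred p) · 1# - 1#   ≈⟨ +-congʳ (reflexive (≡.cong (_· 1#) (ℕ.suc-pred p))) ⟩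
      p · 1# - 1#                ≈⟨ +-congʳ p×1≈0 ⟩
      0# - 1#                     ≈⟨ +-identityˡ _ ⟩
      - 1#                        ∎)
    -1*x≈-x : - 1# * x ≈ - x
    -1*x≈-x = solve 1 (λ x → (:- :1) :* x := :- x) refl x

  Scalar-- : ∀ {x y} → Scalar x → Scalar y → Scalar (x - y)
  Scalar-- x∈P y∈P = Scalar-+ x∈P (Scalar-neg y∈P)

  residue : ∀ n → (n % p) · 1# ≈ n · 1#
  residue n = begin
    (n % p) · 1#                            ≈⟨ +-identityʳ _ ⟨
    (n % p) · 1# + 0#                       ≈⟨ +-congˡ (zeroʳ _) ⟨
    (n % p) · 1# + (n / p) · 1# * 0#        ≈⟨ +-congˡ (*-congˡ p×1≈0) ⟨
    (n % p) · 1# + (n / p) · 1# * p · 1#    ≈⟨ +-congˡ (×1-homo-* (n / p) p) ⟨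
    (n % p) · 1# + (n / p ℕ.* p) · 1#       ≈⟨ ×-homo-+ 1# (n % p) (n / p ℕ.* p) ⟨
    (n % p ℕ.+ n / p ℕ.* p) · 1#            ≈⟨ reflexive (≡.cong (_· 1#) (m≡m%n+[m/n]*n n p)) ⟨
    n · 1#                                  ∎

  -- As 0 < n < p, the numbers n and p are coprime, and the Bézout coefficient of n is an inverse
  -- once multiples of p vanish. It is negated when the identity has the multiple of p on its larger
  -- side.
  residue-inverse : ∀ n → .{{ℕ.NonZero n}} → n < p → ∃ λ y → Scalar y × y * (n · 1#) ≈ 1#
  residue-inverse n n<p with coprime-Bézout (prime⇒coprime p-prime n<p)
  ... | Bézout.+- a b 1+bn≡ap = - (b · 1#) , Scalar-neg (b , refl) , (begin
    - (b · 1#) * (n · 1#)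
      ≈⟨ solve 2 (λ b n → (:- b) :* n := :1 :- (:1 :+ b :* n)) refl (b · 1#) (n · 1#) ⟩
    1# - (1# + b · 1# * n · 1#)
      ≈⟨ +-congˡ (-‿cong (+-congˡ (×1-homo-* b n))) ⟨
    1# - (1 ℕ.+ b ℕ.* n) · 1#
      ≈⟨ +-congˡ (-‿cong (reflexive (≡.cong (_· 1#) 1+bn≡ap))) ⟩
    1# - (a ℕ.* p) · 1#
      ≈⟨ +-congˡ (-‿cong (trans (×1-homo-* a p) (*-congˡ p×1≈0))) ⟩
    1# - a · 1# * 0#
      ≈⟨ solve 1 (λ a → :1 :- a :* :0 := :1) refl (a · 1#) ⟩
    1#  ∎)
  ... | Bézout.-+ a b 1+ap≡bn = b · 1# , (b , refl) , (begin
    b · 1# * n · 1#                 ≈⟨ ×1-homo-* b n ⟨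
    (b ℕ.* n) · 1#                   ≈⟨ reflexive (≡.cong (_· 1#) 1+ap≡bn) ⟨
    1# + (a ℕ.* p) · 1#              ≈⟨ +-congˡ (trans (×1-homo-* a p) (*-congˡ p×1≈0)) ⟩
    1# + a · 1# * 0#                 ≈⟨ solve 1 (λ a → :1 :+ a :* :0 := :1) refl (a · 1#) ⟩
    1#                                ∎)

  -- The multiplier is first reduced modulo p. Residue zero would give x = 0, and any other residue
  -- falls under `residue-inverse`.
  Scalar-inverse : ∀ {x} → Scalar x → ¬ x ≈ 0# → ∃ λ y → Scalar y × y * x ≈ 1#
  Scalar-inverse (n , n≈x) x≉0 with n % p in n%p≡r | m%n<n n p
  ... | zero  | _   = contradiction (trans (sym n≈x) (trans (sym (residue n))
                        (reflexive (≡.cong (_· 1#) n%p≡r)))) x≉0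
  ... | suc r | r<p with residue-inverse (suc r) r<p
  ...   | y , y∈P , yr≈1 = y , y∈P , trans (*-congˡ (trans (sym n≈x) (trans (sym (residue n))
                             (reflexive (≡.cong (_· 1#) n%p≡r))))) yr≈1

  Scalar-cancel : ∀ {x y} → Scalar x → ¬ x ≈ 0# → Scalar (x * y) → Scalar y
  Scalar-cancel {x} {y} x∈P x≉0 xy∈P with Scalar-inverse x∈P x≉0
  ... | x⁻¹ , x⁻¹∈P , x⁻¹x≈1 = Scalar-resp-≈
    (trans (sym (*-assoc _ _ _)) (trans (*-congʳ x⁻¹x≈1) (*-identityˡ y)))
    (Scalar-* x⁻¹∈P xy∈P)

  ι : Fin p → Carrier
  ι i = toℕ i · 1#

  ι-Scalar : ∀ i → Scalar (ι i)
  ι-Scalar i = toℕ i , refl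

  ι-surjective : ∀ {x} → Scalar x → ∃ λ i → ι i ≈ x
  ι-surjective (n , n≈x) = Fin.fromℕ< (m%n<n n p) ,
    trans (reflexive (≡.cong (_· 1#) (toℕ-fromℕ< (m%n<n n p)))) (trans (residue n) n≈x)

  private
    -- The gap n - m is below p and its multiple of 1 vanishes. A positive gap would be invertible,
    -- which is impossible for zero.
    ×1-injective-≤ : ∀ {m n} → m ≤ n → n < p → m · 1# ≈ n · 1# → m ≡ n
    ×1-injective-≤ {m} {n} m≤n n<p m≈n = from-gap (n ℕ.∸ m) (ℕ.m+[n∸m]≡n m≤n)
      where
      from-gap : ∀ d → m ℕ.+ d ≡ n → m ≡ n
      from-gap zero    m+0≡n = ≡.trans (≡.sym (ℕ.+-identityʳ m)) m+0≡n
      from-gap (suc d) m+d≡n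
        with residue-inverse (suc d) (ℕ.≤-<-trans (≡.subst (suc d ≤_) m+d≡n (ℕ.m≤n+m (suc d) m)) n<p)
      ... | y , _ , yd≈1 = contradiction (trans (sym yd≈1) (trans (*-congˡ d≈0) (zeroʳ y))) 1≉0
        where
        d≈0 : suc d · 1# ≈ 0#
        d≈0 = begin
          suc d · 1#
            ≈⟨ solve 2 (λ m d → d := m :+ d :- m) refl (m · 1#) (suc d · 1#) ⟩
          m · 1# + suc d · 1# - m · 1#
            ≈⟨ +-congʳ (×-homo-+ 1# m (suc d)) ⟨
          (m ℕ.+ suc d) · 1# - m · 1#
            ≈⟨ +-cong (reflexive (≡.cong (_· 1#) m+d≡n)) (-‿cong m≈n) ⟩
          n · 1# - n · 1#
            ≈⟨ -‿inverseʳ _ ⟩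
          0#  ∎

  ι-injective : ∀ {i j} → ι i ≈ ι j → i ≡ j
  ι-injective {i} {j} i≈j with ℕ.≤-total (toℕ i) (toℕ j)
  ... | inj₁ i≤j = toℕ-injective (×1-injective-≤ i≤j (toℕ<n j) i≈j)
  ... | inj₂ j≤i = toℕ-injective (≡.sym (×1-injective-≤ j≤i (toℕ<n i) (sym i≈j)))

  -- Tuples of scalars, enumerated by base-p digits.

  digits : ∀ k → Fin (p ^ k) → Fin k → Carrier
  digits k i l = ι (finToFun i l)

  digits∈P : ∀ k i l → Scalar (digits k i l)
  digits∈P k i l = ι-Scalar (finToFun i l)

  digits-injective : ∀ k {i j} → (∀ l → digits k i l ≈ digits k j l) → i ≡ j
  digits-injective k {i} {j} eq = ≡.trans (≡.sym (funToFin-finToFin {k} i))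
    (≡.trans (funToFin-cong (λ l → ι-injective (eq l))) (funToFin-finToFin {k} j))
    where
    funToFin-cong : ∀ {m n} {f g : Fin m → Fin n} → (∀ l → f l ≡ g l) → funToFin f ≡ funToFin g
    funToFin-cong {zero}  f≗g = ≡.refl
    funToFin-cong {suc m} f≗g = ≡.cong₂ Fin.combine (f≗g 0F) (funToFin-cong (f≗g ∘ suc))

  digits-surjective : ∀ {k} {a : Fin k → Carrier} → (∀ l → Scalar (a l)) →
    ∃ λ i → ∀ l → digits k i l ≈ a l
  digits-surjective a∈P = funToFin (proj₁ ∘ ι-surjective ∘ a∈P) , λ l →
    trans (reflexive (≡.cong ι (finToFun-funToFin (proj₁ ∘ ι-surjective ∘ a∈P) l)))
          (proj₂ (ι-surjective (a∈P l)))

  -- The coordinate m at e₁ for a basis of F over P that extends (e₀, e₁).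
  record Coordinate (e₀ e₁ : Carrier) : Set (c ⊔ ℓ) where
    field
      m       : Carrier → Carrier
      m-cong  : ∀ {x y} → x ≈ y → m x ≈ m y
      m--     : ∀ x y → m (x - y) ≈ m x - m y
      m-*     : ∀ {t} → Scalar t → ∀ x → m (t * x) ≈ t * m x
      m∈P     : ∀ x → Scalar (m x)
      m-e₀    : m e₀ ≈ 0#
      m-e₁    : m e₁ ≈ 1#
      fibre₁            : Fin (p ^ 2) → Carrier
      m-fibre₁          : ∀ i → m (fibre₁ i) ≈ 1#
      fibre₁-surjective : ∀ {x} → m x ≈ 1# → ∃ λ i → fibre₁ i ≈ x

  -- A basis of F over P extending two independent elements, and its coordinates.

  module _ {e₀ e₁ : Carrier} (e₁≉0 : ¬ e₁ ≈ 0#)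
           (e₀∉⟨e₁⟩ : ∀ {t} → Scalar t → ¬ t * e₁ ≈ e₀) where

    private
      pair : Carrier → Carrier → Fin 2 → Carrier
      pair s t 0F = s
      pair s t 1F = t

      pair∈P : ∀ {s t} → Scalar s → Scalar t → ∀ l → Scalar (pair s t l)
      pair∈P s∈P t∈P 0F = s∈P
      pair∈P s∈P t∈P 1F = t∈P

      triple : Carrier → Carrier → Carrier → Fin 3 → Carrier
      triple r s t 0F      = r
      triple r s t (suc l) = pair s t l

      triple∈P : ∀ {r s t} → Scalar r → Scalar s → Scalar t → ∀ l → Scalar (triple r s t l)
      triple∈P r∈P s∈P t∈P 0F      = r∈P
      triple∈P r∈P s∈P t∈P (suc l) = pair∈P s∈P t∈P l

      -- The span of `e₀` and `e₁` has at most p² elements, fewer than the p³ elements of the field.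
      outside-span : ∃ λ e₂ → ∀ i → ¬ digits 2 i 0F * e₀ + digits 2 i 1F * e₁ ≈ e₂
      outside-span = fresh (ℕ.^-monoʳ-< p 1<p (ℕ.n<1+n 2)) _

      e₂ : Carrier
      e₂ = proj₁ outside-span

      e₂∉span : ∀ {s t} → Scalar s → Scalar t → ¬ s * e₀ + t * e₁ ≈ e₂
      e₂∉span s∈P t∈P eq = let i , i≈ = digits-surjective (pair∈P s∈P t∈P) in
        proj₂ outside-span i (trans (+-cong (*-congʳ (i≈ 0F)) (*-congʳ (i≈ 1F))) eq)

      -- A linear relation expresses the term with nonzero coefficient through the others; the
      -- factor is -1/t. This turns a dependence into membership in a span.
      solve-for : ∀ {t x y} → Scalar t → ¬ t ≈ 0# → x + t * y ≈ 0# →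
        ∃ λ s → Scalar s × s * x ≈ y
      solve-for {t} {x} {y} t∈P t≉0 x+ty≈0 with Scalar-inverse t∈P t≉0
      ... | u , u∈P , ut≈1 = - u , Scalar-neg u∈P , (begin
        - u * x
          ≈⟨ solve 4 (λ u t x y → (:- u) :* x := u :* t :* y :- u :* (x :+ t :* y)) refl u t x y ⟩
        u * t * y - u * (x + t * y)
          ≈⟨ +-cong (*-congʳ ut≈1) (-‿cong (*-congˡ x+ty≈0)) ⟩
        1# * y - u * 0#
          ≈⟨ solve 2 (λ u y → :1 :* y :- u :* :0 := y) refl u y ⟩
        y  ∎)

      combination : (Fin 3 → Carrier) → Carrier
      combination a = a 0F * e₀ + a 1F * e₁ + a 2F * e₂

      combination-cong : ∀ {a b} → (∀ l → a l ≈ b l) → combination a ≈ combination b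
      combination-cong a≈b =
        +-cong (+-cong (*-congʳ (a≈b 0F)) (*-congʳ (a≈b 1F))) (*-congʳ (a≈b 2F))

      combination-- : ∀ a b → combination (λ l → a l - b l) ≈ combination a - combination b
      combination-- a b = trans (+-cong (+-cong (expand 0F e₀) (expand 1F e₁)) (expand 2F e₂))
        (solve 6 (λ a₀ a₁ a₂ b₀ b₁ b₂ →
            a₀ :- b₀ :+ (a₁ :- b₁) :+ (a₂ :- b₂) := a₀ :+ a₁ :+ a₂ :- (b₀ :+ b₁ :+ b₂))
          refl (a 0F * e₀) (a 1F * e₁) (a 2F * e₂) (b 0F * e₀) (b 1F * e₁) (b 2F * e₂))
        where
        expand : ∀ l e → (a l - b l) * e ≈ a l * e - b l * e
        expand l e = [y-z]x≈yx-zx e (a l) (b l)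

      combination-* : ∀ t a → combination (λ l → t * a l) ≈ t * combination a
      combination-* t a =
        solve 7 (λ t a₀ a₁ a₂ e₀ e₁ e₂ →
            (t :* a₀) :* e₀ :+ (t :* a₁) :* e₁ :+ (t :* a₂) :* e₂ :=
            t :* (a₀ :* e₀ :+ a₁ :* e₁ :+ a₂ :* e₂))
          refl t (a 0F) (a 1F) (a 2F) e₀ e₁ e₂

      -- Elimination from the last vector: a nonzero coefficient of `e₂` would put it in the span of
      -- the others, then a nonzero coefficient of `e₀` would make it a multiple of `e₁`, and
      -- finally `e₁` itself is nonzero.
      independent : ∀ {a} → (∀ l → Scalar (a l)) → combination a ≈ 0# → ∀ l → a l ≈ 0#
      independent {a} a∈P eq = λ { 0F → r≈0 ; 1F → s≈0 ; 2F → t≈0 }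
        where
        r = a 0F
        s = a 1F
        t = a 2F

        t≈0 : t ≈ 0#
        t≈0 = decidable-stable (t ≟ 0#) λ t≉0 → let u , u∈P , eq′ = solve-for (a∈P 2F) t≉0 eq in
          e₂∉span (Scalar-* u∈P (a∈P 0F)) (Scalar-* u∈P (a∈P 1F)) (trans
            (solve 5 (λ u r s a b → u :* r :* a :+ u :* s :* b := u :* (r :* a :+ s :* b))
              refl u r s e₀ e₁) eq′)

        eq₁ : s * e₁ + r * e₀ ≈ 0#
        eq₁ = begin
          s * e₁ + r * e₀
            ≈⟨ solve 3 (λ x y z → y :+ x := x :+ y :+ :0 :* z) refl (r * e₀) (s * e₁) e₂ ⟩
          r * e₀ + s * e₁ + 0# * e₂
            ≈⟨ +-congˡ (*-congʳ t≈0) ⟨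
          combination a
            ≈⟨ eq ⟩
          0#  ∎

        r≈0 : r ≈ 0#
        r≈0 = decidable-stable (r ≟ 0#) λ r≉0 → let u , u∈P , eq′ = solve-for (a∈P 0F) r≉0 eq₁ in
          e₀∉⟨e₁⟩ (Scalar-* u∈P (a∈P 1F)) (trans (*-assoc u s e₁) eq′)

        s≈0 : s ≈ 0#
        s≈0 = *-cancel-0 e₁≉0 (begin
          e₁ * s                 ≈⟨ solve 3 (λ s a b → b :* s := s :* b :+ :0 :* a) refl s e₀ e₁ ⟩
          s * e₁ + 0# * e₀       ≈⟨ +-congˡ (*-congʳ r≈0) ⟨
          s * e₁ + r * e₀        ≈⟨ eq₁ ⟩
          0#                     ∎)

      combination-injective : ∀ {a b} → (∀ l → Scalar (a l)) → (∀ l → Scalar (b l)) →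
        combination a ≈ combination b → ∀ l → a l ≈ b l
      combination-injective {a} {b} a∈P b∈P eq l = x-y≈0⇒x≈y _ _
        (independent (λ l → Scalar-- (a∈P l) (b∈P l))
          (trans (combination-- a b) (x≈y⇒x-y≈0 eq)) l)

      -- There are p³ coefficient triples and p³ field elements. Independence excludes a collision,
      -- so every element is hit.
      decode : ∀ x → ∃ λ i → combination (digits 3 i) ≈ x
      decode x with hit-or-collision (combination ∘ digits 3) x
      ... | inj₁ hit                = hit
      ... | inj₂ (i , j , i≢j , eq) = contradiction
        (digits-injective 3 (combination-injective (digits∈P 3 i) (digits∈P 3 j) eq)) i≢j

      coordinates : Carrier → Fin 3 → Carrier
      coordinates x = digits 3 (proj₁ (decode x))

      coordinates∈P : ∀ x l → Scalar (coordinates x l)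
      coordinates∈P x = digits∈P 3 (proj₁ (decode x))

      combination-coordinates : ∀ x → combination (coordinates x) ≈ x
      combination-coordinates x = proj₂ (decode x)

      -- Coordinates come from a search and obey no law by construction. Their congruence, linearity
      -- and values at the basis all follow by exhibiting a scalar triple with the right
      -- combination.
      coordinates-unique : ∀ {a x} → (∀ l → Scalar (a l)) → combination a ≈ x →
        ∀ l → coordinates x l ≈ a l
      coordinates-unique {a} {x} a∈P eq = combination-injective (coordinates∈P x) a∈P
        (trans (combination-coordinates x) (sym eq))

    abstract
      coordinate : Coordinate e₀ e₁
      coordinate = record
        { m      = λ x → coordinates x 1F
        ; m-cong = λ {x} {y} x≈y → coordinates-unique (coordinates∈P y)
                     (trans (combination-coordinates y) (sym x≈y)) 1F
        ; m--    = λ x y → coordinates-unique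
                     (λ l → Scalar-- (coordinates∈P x l) (coordinates∈P y l))
                     (trans (combination-- (coordinates x) (coordinates y))
                       (+-cong (combination-coordinates x) (-‿cong (combination-coordinates y)))) 1F
        ; m-*    = λ {t} t∈P x → coordinates-unique (λ l → Scalar-* t∈P (coordinates∈P x l))
                     (trans (combination-* t (coordinates x)) (*-congˡ (combination-coordinates x))) 1F
        ; m∈P    = λ x → coordinates∈P x 1F
        ; m-e₀   = coordinates-unique (triple∈P Scalar-1 Scalar-0 Scalar-0)
                     (solve 3 (λ e₀ e₁ e₂ → :1 :* e₀ :+ :0 :* e₁ :+ :0 :* e₂ := e₀) refl e₀ e₁ e₂) 1F
        ; m-e₁   = coordinates-unique (triple∈P Scalar-0 Scalar-1 Scalar-0)
                     (solve 3 (λ e₀ e₁ e₂ → :0 :* e₀ :+ :1 :* e₁ :+ :0 :* e₂ := e₁) refl e₀ e₁ e₂) 1F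
        ; fibre₁            = fibre
        ; m-fibre₁          = λ i → coordinates-unique
                                (triple∈P (digits∈P 2 i 0F) Scalar-1 (digits∈P 2 i 1F)) refl 1F
        ; fibre₁-surjective = fibre-surjective
        }
        where
        -- The coefficient at `e₁` is fixed to 1 and the two others are free, which gives p²
        -- elements.
        fibre : Fin (p ^ 2) → Carrier
        fibre i = combination (triple (digits 2 i 0F) 1# (digits 2 i 1F))

        fibre-surjective : ∀ {x} → coordinates x 1F ≈ 1# → ∃ λ i → fibre i ≈ x
        fibre-surjective {x} mx≈1 =
          let i , i≈ = digits-surjective (pair∈P (coordinates∈P x 0F) (coordinates∈P x 2F)) in
          i , trans (combination-cong {triple (digits 2 i 0F) 1# (digits 2 i 1F)} {coordinates x}
                      λ { 0F → i≈ 0F ; 1F → sym mx≈1 ; 2F → i≈ 1F })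
                    (combination-coordinates x)

-- Finite sets of projective points and their enlargement.

module PointSets {c ℓ} (F : CommutativeRing c ℓ) (isField : IsField F)
                 {q : ℕ} (order : HasOrder F q) where
  open CommutativeRing F hiding (zero)
  open IsField isField
  open HasOrder order
  open FiniteField F isField order
  open IntegerSolver F
  open ProjectivePlane F
  open PointSet
  open import Relation.Binary.Reasoning.Setoid setoid

  Proportional-trans : ∀ {P Q R} → Proportional P Q → Proportional Q R → Proportional P R
  Proportional-trans (s , s≉0 , x , y , z) (t , t≉0 , x′ , y′ , z′) =
    t * s , t≉0 ∘ (λ ts≈0 → contradiction (*-cancel-0 t≉0 ts≈0) s≉0) ,
    scale x x′ , scale y y′ , scale z z′
    where
    scale : ∀ {x y z} → s * x ≈ y → t * y ≈ z → t * s * x ≈ z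
    scale sx≈y ty≈z = trans (*-assoc t s _) (trans (*-congˡ sx≈y) ty≈z)

  Proportional-sym : ∀ {P Q} → Proportional P Q → Proportional Q P
  Proportional-sym (t , t≉0 , x , y , z) with inverse t t≉0
  ... | t⁻¹ , tt⁻¹≈1 = t⁻¹ , t⁻¹≉0 , unscale x , unscale y , unscale z
    where
    t⁻¹≉0 : ¬ t⁻¹ ≈ 0#
    t⁻¹≉0 t⁻¹≈0 = 1≉0 (trans (sym tt⁻¹≈1) (trans (*-congˡ t⁻¹≈0) (zeroʳ t)))
    unscale : ∀ {x y} → t * x ≈ y → t⁻¹ * y ≈ x
    unscale {x} {y} tx≈y = begin
      t⁻¹ * y        ≈⟨ *-congˡ tx≈y ⟨
      t⁻¹ * (t * x)  ≈⟨ solve 3 (λ t u x → u :* (t :* x) := t :* u :* x) refl t t⁻¹ x ⟩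
      t * t⁻¹ * x    ≈⟨ *-congʳ tt⁻¹≈1 ⟩
      1# * x         ≈⟨ *-identityˡ x ⟩
      x              ∎

  Proportional? : Decidable Proportional
  Proportional? (x , y , z) (x′ , y′ , z′) = map′
    (λ (i , proportional) → enum i , proportional)
    (λ (t , t≉0 , tx , ty , tz) → index t , t≉0 ∘ trans (sym (enum-index t)) ,
      trans (*-congʳ (enum-index t)) tx ,
      trans (*-congʳ (enum-index t)) ty ,
      trans (*-congʳ (enum-index t)) tz)
    (any? λ i → ¬? (enum i ≟ 0#) ×-dec
      (enum i * x ≟ x′) ×-dec (enum i * y ≟ y′) ×-dec (enum i * z ≟ z′))

  Incident-resp-Proportional : ∀ {P Q} L → Proportional P Q → Incident P L → Incident Q L
  Incident-resp-Proportional {x , y , z} {x′ , y′ , z′} (a , b , d) (t , _ , tx , ty , tz) inc = begin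
    a * x′ + b * y′ + d * z′
      ≈⟨ +-cong (+-cong (*-congˡ tx) (*-congˡ ty)) (*-congˡ tz) ⟨
    a * (t * x) + b * (t * y) + d * (t * z)
      ≈⟨ solve 7 (λ a b d t x y z → a :* (t :* x) :+ b :* (t :* y) :+ d :* (t :* z) :=
                                    t :* (a :* x :+ b :* y :+ d :* z)) refl a b d t x y z ⟩
    t * (a * x + b * y + d * z)
      ≈⟨ *-congˡ inc ⟩
    t * 0#
      ≈⟨ zeroʳ t ⟩
    0#  ∎

  _Covers_ : ∀ {k} → PointSet k → Triple → Set (c ⊔ ℓ)
  B Covers P = ∃ λ j → Proportional (pt B j) P

  covers? : ∀ {k} (B : PointSet k) P → Dec (B Covers P)
  covers? B P = any? λ j → Proportional? (pt B j) P

  _⊑_ : ∀ {k l} → PointSet k → PointSet l → Set (c ⊔ ℓ)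
  B ⊑ B′ = ∀ {P} → B Covers P → B′ Covers P

  empty : PointSet 0
  empty = record { pt = λ () ; nonzero = λ () ; distinct = λ () }

  insert : ∀ {k} (B : PointSet k) P → NonZero P → ¬ B Covers P → PointSet (suc k)
  insert {k} B P P≠0 new = record { pt = pt′ ; nonzero = nonzero′ ; distinct = distinct′ }
    where
    pt′ : Fin (suc k) → Triple
    pt′ zero    = P
    pt′ (suc i) = pt B i
    nonzero′ : ∀ i → NonZero (pt′ i)
    nonzero′ zero    = P≠0
    nonzero′ (suc i) = nonzero B i
    distinct′ : ∀ i j → Proportional (pt′ i) (pt′ j) → i ≡ j
    distinct′ zero    zero    _  = ≡.refl
    distinct′ zero    (suc j) P∝ = contradiction (j , Proportional-sym P∝) new
    distinct′ (suc i) zero    ∝P = contradiction (i , ∝P) new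
    distinct′ (suc i) (suc j) ∝  = ≡.cong suc (distinct B i j ∝)

  ⊑-insert : ∀ {k} (B : PointSet k) P P≠0 new → B ⊑ insert B P P≠0 new
  ⊑-insert B P P≠0 new (j , ∝) = suc j , ∝

  Proportional-refl : ∀ {P} → Proportional P P
  Proportional-refl = 1# , 1≉0 , *-identityˡ _ , *-identityˡ _ , *-identityˡ _

  -- A point proportional to an earlier choice is skipped, so a list with repetitions is allowed and
  -- its length is only an upper bound for the size.
  fromList : ∀ Ps → All NonZero Ps →
    ∃ λ k → k ≤ length Ps × Σ (PointSet k) λ B → ∀ {P} → P ∈ Ps → B Covers P
  fromList []       []           = 0 , z≤n , empty , λ ()
  fromList (P ∷ Ps) (P≠0 ∷ Ps≠0) with fromList Ps Ps≠0
  ... | k , k≤ , B , covers with covers? B P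
  ...   | yes old = k , ℕ.m≤n⇒m≤1+n k≤ , B , λ { (here ≡.refl) → old ; (there P∈) → covers P∈ }
  ...   | no new  = suc k , s≤s k≤ , insert B P P≠0 new , λ
    { (here ≡.refl) → zero , Proportional-refl
    ; (there P∈)    → ⊑-insert B P P≠0 new (covers P∈) }

  -- These q² pairwise distinct points are the supply from which a point set is enlarged.
  affine : Fin (q ℕ.* q) → Triple
  affine i = enum (proj₁ (Fin.remQuot {q} q i)) , enum (proj₂ (Fin.remQuot {q} q i)) , 1#

  affine-nonzero : ∀ i → NonZero (affine i)
  affine-nonzero i (_ , _ , 1≈0) = 1≉0 1≈0

  affine-injective : ∀ {i j} → Proportional (affine i) (affine j) → i ≡ j
  affine-injective {i} {j} (t , _ , x , y , t1≈1) =
    ≡.trans (≡.sym (combine-remQuot {q} q i))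
      (≡.trans (≡.cong₂ Fin.combine (unscale x) (unscale y)) (combine-remQuot {q} q j))
    where
    unscale : ∀ {a b} → t * enum a ≈ enum b → a ≡ b
    unscale {a} {b} ta≈b = enum-inj a b (begin
      enum a       ≈⟨ *-identityˡ _ ⟨
      1# * enum a  ≈⟨ *-congʳ (trans (sym (*-identityʳ t)) t1≈1) ⟨
      t * enum a   ≈⟨ ta≈b ⟩
      enum b       ∎)

  -- If fewer than q² points covered all affine points, one of them would be proportional to two
  -- distinct affine points.
  uncovered : ∀ {k} (B : PointSet k) → k < q ℕ.* q → ∃ λ i → ¬ B Covers affine i
  uncovered {k} B k<q² = ¬∀⟶∃¬ _ _ (λ i → covers? B (affine i)) λ covered →
    let i , j , i<j , eq = pigeonhole k<q² (proj₁ ∘ covered) in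
    <ᶠ⇒≢ i<j (affine-injective (Proportional-trans
      (Proportional-sym (proj₂ (covered i)))
      (≡.subst (λ l → Proportional (pt B l) (affine j)) (≡.sym eq) (proj₂ (covered j)))))

  -- The recursion on `≤′` adds one uncovered affine point per step. The bound n ≤ q² guarantees
  -- that such a point exists each time.
  pad : ∀ {k n} → k ℕ.≤′ n → n ≤ q ℕ.* q → (B : PointSet k) → Σ (PointSet n) (B ⊑_)
  pad ℕ.≤′-refl        _    B = B , λ covered → covered
  pad (ℕ.≤′-step k≤′n) n<q² B =
    let B′ , B⊑B′ = pad k≤′n (ℕ.<⇒≤ n<q²) B
        i , new   = uncovered B′ n<q²
    in insert B′ (affine i) (affine-nonzero i) new ,
       ⊑-insert B′ (affine i) (affine-nonzero i) new ∘ B⊑B′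

  Blocks : List Triple → Set (c ⊔ ℓ)
  Blocks Ps = ∀ L → NonZero L → ∃ λ P → P ∈ Ps × Incident P L

  -- Every line meets each list, and the two points found are different because no point of one list
  -- is proportional to a point of the other. Enlarging the union keeps both points.
  disjoint-blocking⇒2-fold : ∀ {n Ps Qs} → All NonZero Ps → All NonZero Qs →
    length Ps ℕ.+ length Qs ≤ n → n ≤ q ℕ.* q →
    (∀ {P Q} → P ∈ Ps → Q ∈ Qs → ¬ Proportional P Q) → Blocks Ps → Blocks Qs →
    Σ (PointSet n) Is2FoldBlocking
  disjoint-blocking⇒2-fold {n} {Ps} {Qs} Ps≠0 Qs≠0 size≤n n≤q² disjoint Ps-block Qs-block
    with fromList (Ps ++ Qs) (++⁺ Ps≠0 Qs≠0)
  ... | k , k≤ , B₀ , B₀-covers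
    with pad (ℕ.≤⇒≤′ (ℕ.≤-trans k≤ (ℕ.≤-trans (ℕ.≤-reflexive (length-++ Ps)) size≤n))) n≤q² B₀
  ... | B , B₀⊑B = B , λ L L≠0 →
    let P , P∈ , P-inc = Ps-block L L≠0
        Q , Q∈ , Q-inc = Qs-block L L≠0
        i , i∝P = B₀⊑B (B₀-covers (∈-++⁺ˡ P∈))
        j , j∝Q = B₀⊑B (B₀-covers (∈-++⁺ʳ Ps Q∈))
    in i , j
     -- The point set represents P and Q only up to a factor; a shared index would make them
     -- proportional to each other.
     , (λ i≡j → disjoint P∈ Q∈ (Proportional-trans (Proportional-sym i∝P)
         (≡.subst (λ l → Proportional (pt B l) Q) (≡.sym i≡j) j∝Q)))
     , Incident-resp-Proportional L (Proportional-sym i∝P) P-inc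
     , Incident-resp-Proportional L (Proportional-sym j∝Q) Q-inc

-- Leaves room for the enlargement within the p⁶ affine points. Each doubling is absorbed by one
-- more factor p ≥ 2.
2[p³+p²+p+1]≤p⁶ : ∀ {p} → 1 < p → 2 ℕ.* (p ^ 3 ℕ.+ p ^ 2 ℕ.+ p ℕ.+ 1) ≤ p ^ 3 ℕ.* p ^ 3
2[p³+p²+p+1]≤p⁶ {p} 1<p = begin
  2 ℕ.* (p ^ 3 ℕ.+ p ^ 2 ℕ.+ p ℕ.+ 1)      ≡⟨ ≡.cong (2 ℕ.*_) (ℕ.+-assoc (p ^ 3 ℕ.+ p ^ 2) p 1) ⟩
  2 ℕ.* (p ^ 3 ℕ.+ p ^ 2 ℕ.+ (p ℕ.+ 1))    ≤⟨ ℕ.*-monoʳ-≤ 2 (ℕ.+-monoʳ-≤ (p ^ 3 ℕ.+ p ^ 2) p+1≤p²) ⟩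
  2 ℕ.* (p ^ 3 ℕ.+ p ^ 2 ℕ.+ p ^ 2)        ≡⟨ ≡.cong (2 ℕ.*_) (ℕ.+-assoc (p ^ 3) (p ^ 2) (p ^ 2)) ⟩
  2 ℕ.* (p ^ 3 ℕ.+ (p ^ 2 ℕ.+ p ^ 2))      ≤⟨ ℕ.*-monoʳ-≤ 2 (ℕ.+-monoʳ-≤ (p ^ 3) (double (p ^ 2))) ⟩
  2 ℕ.* (p ^ 3 ℕ.+ p ^ 3)                  ≤⟨ ℕ.*-monoʳ-≤ 2 (double (p ^ 3)) ⟩
  2 ℕ.* p ^ 4                              ≤⟨ ℕ.*-monoˡ-≤ (p ^ 4) 1<p ⟩
  p ^ 5                                    ≤⟨ ℕ.^-monoʳ-≤ p {{ℕ.>-nonZero (ℕ.<⇒≤ 1<p)}} (ℕ.n≤1+n 5) ⟩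
  p ^ 6                                    ≡⟨ ℕ.^-distribˡ-+-* p 3 3 ⟩
  p ^ 3 ℕ.* p ^ 3                          ∎
  where
  open ℕ.≤-Reasoning
  double : ∀ n → n ℕ.+ n ≤ p ℕ.* n
  double n = ≡.subst (_≤ p ℕ.* n) (≡.cong (n ℕ.+_) (ℕ.+-identityʳ n)) (ℕ.*-monoˡ-≤ n 1<p)
  p+1≤p² : p ℕ.+ 1 ≤ p ^ 2
  p+1≤p² = ℕ.≤-trans (ℕ.+-monoʳ-≤ p (ℕ.<⇒≤ 1<p))
    (≡.subst (p ℕ.+ p ≤_) (≡.cong (p ℕ.*_) (≡.sym (ℕ.*-identityʳ p))) (double p))

-- Two disjoint blocking sets.

module DisjointBlockingSets {c ℓ} (F : CommutativeRing c ℓ) (isField : IsField F)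
                            {p : ℕ} (p-prime : Prime p) (order : HasOrder F (p ^ 3)) where
  open CommutativeRing F hiding (zero)
  open IsField isField
  open HasOrder order
  open FiniteField F isField order
  open CubicExtension F isField p-prime order
  open PointSets F isField order using (Blocks)
  open ProjectivePlane F
  open IntegerSolver F
  open import Relation.Binary.Reasoning.Setoid setoid

  -- The function `inverse` comes without a congruence law, so reciprocals of equal elements are
  -- compared through uniqueness.
  inverse-unique : ∀ {x x′ y y′} → x * y ≈ 1# → x′ * y′ ≈ 1# → y ≈ y′ → x ≈ x′
  inverse-unique {x} {x′} {y} {y′} xy≈1 x′y′≈1 y≈y′ = begin
    x               ≈⟨ *-identityʳ x ⟨
    x * 1#          ≈⟨ *-congˡ x′y′≈1 ⟨
    x * (x′ * y′)   ≈⟨ *-congˡ (*-congˡ y≈y′) ⟨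
    x * (x′ * y)    ≈⟨ solve 3 (λ x x′ y → x :* (x′ :* y) := x :* y :* x′) refl x x′ y ⟩
    x * y * x′      ≈⟨ *-congʳ xy≈1 ⟩
    1# * x′         ≈⟨ *-identityˡ x′ ⟩
    x′              ∎

  module CoordinateProperties {e₀ e₁} (C : Coordinate e₀ e₁) where
    open Coordinate C public

    m-0 : ∀ {x} → x ≈ 0# → m x ≈ 0#
    m-0 {x} x≈0 = begin
      m x         ≈⟨ m-cong (trans x≈0 (sym (zeroˡ 0#))) ⟩
      m (0# * 0#) ≈⟨ m-* Scalar-0 0# ⟩
      0# * m 0#   ≈⟨ zeroˡ _ ⟩
      0#          ∎

    -- A kernel element x with m x = 0 satisfies A x = 0, hence A = 0. Otherwise it can be divided
    -- by the scalar m x, which puts it into the fibre over 1.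
    zero-or-fibre₁ : ∀ A B → (∃ λ x → ¬ x ≈ 0# × A * x + B * m x ≈ 0#) →
      (∃ λ i → A * fibre₁ i + B ≈ 0#) ⊎ A ≈ 0#
    zero-or-fibre₁ A B (x , x≉0 , eq) with m x ≟ 0#
    ... | yes mx≈0 = inj₂ (*-cancel-0 x≉0 (begin
      x * A             ≈⟨ solve 3 (λ a b x → x :* a := a :* x :+ b :* :0) refl A B x ⟩
      A * x + B * 0#    ≈⟨ +-congˡ (*-congˡ mx≈0) ⟨
      A * x + B * m x   ≈⟨ eq ⟩
      0#                ∎))
    ... | no mx≉0 with Scalar-inverse (m∈P x) mx≉0
    ...   | t , t∈P , tmx≈1 with fibre₁-surjective (trans (m-* t∈P x) tmx≈1)
    ...     | i , i≈tx = inj₁ (i , (begin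
      A * fibre₁ i + B
        ≈⟨ +-cong (*-congˡ i≈tx) (trans (sym (*-identityʳ B)) (*-congˡ (sym tmx≈1))) ⟩
      A * (t * x) + B * (t * m x)
        ≈⟨ solve 5 (λ a b t x y → a :* (t :* x) :+ b :* (t :* y) := t :* (a :* x :+ b :* y))
             refl A B t x (m x) ⟩
      t * (A * x + B * m x)
        ≈⟨ *-congˡ eq ⟩
      t * 0#
        ≈⟨ zeroʳ t ⟩
      0#  ∎))

    -- The three outcomes match the three kinds of normalised points: a = 1, then a = 0 with m x =
    -- 1, then a = m x = 0.
    line-cases : ∀ A B D →
      (∃ λ i → A * enum i + B * m (enum i) ≈ D) ⊎ (∃ λ i → A * fibre₁ i + B ≈ 0#) ⊎ A ≈ 0#
    line-cases A B D = map₂ (zero-or-fibre₁ A B)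
      (preimage-or-kernel (λ x → A * x + B * m x) additive D)
      where
      additive : ∀ x y → A * (x - y) + B * m (x - y) ≈ A * x + B * m x - (A * y + B * m y)
      additive x y = trans (+-congˡ (*-congˡ (m-- x y)))
        (solve 6 (λ a b x y x′ y′ → a :* (x :- y) :+ b :* (x′ :- y′) :=
                                    a :* x :+ b :* x′ :- (a :* y :+ b :* y′))
          refl A B x y (m x) (m y))

  -- The choice of s, of the forms m and ℓ, and of μ.

  abstract
    non-scalar : ∃ λ s → ¬ Scalar s
    non-scalar = proj₁ outside , λ s∈P →
      let i , ιi≈s = ι-surjective s∈P in proj₂ outside i ιi≈s
      where
      p<p³ : p < p ^ 3
      p<p³ = ≡.subst (_< p ^ 3) (ℕ.^-identityʳ p) (ℕ.^-monoʳ-< p 1<p {1} {3} (s≤s (s≤s z≤n)))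
      outside : ∃ λ x → ∀ i → ¬ ι i ≈ x
      outside = fresh p<p³ ι

  s : Carrier
  s = proj₁ non-scalar

  s∉P : ¬ Scalar s
  s∉P = proj₂ non-scalar

  T+s∉P : ∀ {T} → Scalar T → ¬ Scalar (T + s)
  T+s∉P {T} T∈P T+s∈P = s∉P (Scalar-resp-≈
    (solve 2 (λ T s → T :+ s :- T := s) refl T s) (Scalar-- T+s∈P T∈P))

  T+s≉0 : ∀ {T} → Scalar T → ¬ T + s ≈ 0#
  T+s≉0 T∈P T+s≈0 = T+s∉P T∈P (Scalar-resp-≈ (sym T+s≈0) Scalar-0)

  recip : ∀ {T} → Scalar T → Carrier
  recip T∈P = proj₁ (inverse _ (T+s≉0 T∈P))

  recip-inverse : ∀ {T} (T∈P : Scalar T) → recip T∈P * (T + s) ≈ 1#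
  recip-inverse T∈P = trans (*-comm _ _) (proj₂ (inverse _ (T+s≉0 T∈P)))

  recip≉0 : ∀ {T} (T∈P : Scalar T) → ¬ recip T∈P ≈ 0#
  recip≉0 T∈P r≈0 = 1≉0 (trans (sym (recip-inverse T∈P)) (trans (*-congʳ r≈0) (zeroˡ _)))

  r₀ r₁ : Carrier
  r₀ = recip Scalar-0
  r₁ = recip Scalar-1

  -- A relation t s = 1 with t in P would make s a scalar.
  ℓ-coordinate : Coordinate 1# s
  ℓ-coordinate = coordinate s≉0 λ t∈P ts≈1 →
    s∉P (Scalar-cancel t∈P (t≉0 ts≈1) (Scalar-resp-≈ (sym ts≈1) Scalar-1))
    where
    s≉0 : ¬ s ≈ 0#
    s≉0 s≈0 = s∉P (Scalar-resp-≈ (sym s≈0) Scalar-0)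
    t≉0 : ∀ {t} → t * s ≈ 1# → ¬ t ≈ 0#
    t≉0 ts≈1 t≈0 = 1≉0 (trans (sym ts≈1) (trans (*-congʳ t≈0) (zeroˡ s)))

  -- Here `r₀` is 1/s and `r₁` is 1/(1 + s). A relation t r₁ = r₀ with t in P gives t s = 1 + s, so
  -- (t - 1) s = 1 and s would be a scalar.
  m-coordinate : Coordinate r₀ r₁
  m-coordinate = coordinate (recip≉0 Scalar-1) λ {t} t∈P tr₁≈r₀ →
    let [t-1]s≈1 = begin
          (t - 1#) * s
            ≈⟨ solve 2 (λ t s → (t :- :1) :* s := t :* s :- s) refl t s ⟩
          t * s - s
            ≈⟨ +-congʳ (ts≈1+s t tr₁≈r₀) ⟩
          1# + s - s
            ≈⟨ solve 1 (λ s → :1 :+ s :- s := :1) refl s ⟩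
          1#  ∎
    in s∉P (Scalar-cancel (Scalar-- t∈P Scalar-1) (λ t-1≈0 → 1≉0 (trans (sym [t-1]s≈1)
         (trans (*-congʳ t-1≈0) (zeroˡ s)))) (Scalar-resp-≈ (sym [t-1]s≈1) Scalar-1))
    where
    ts≈1+s : ∀ t → t * r₁ ≈ r₀ → t * s ≈ 1# + s
    ts≈1+s t tr₁≈r₀ = begin
      t * s                          ≈⟨ solve 2 (λ t s → t :* s := t :* (:0 :+ s) :* :1) refl t s ⟩
      t * (0# + s) * 1#              ≈⟨ *-congˡ (recip-inverse Scalar-1) ⟨
      t * (0# + s) * (r₁ * (1# + s)) ≈⟨ solve 4 (λ t u r v → t :* u :* (r :* v) := t :* r :* u :* v)
                                          refl t (0# + s) r₁ (1# + s) ⟩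
      t * r₁ * (0# + s) * (1# + s)   ≈⟨ *-congʳ (*-congʳ tr₁≈r₀) ⟩
      r₀ * (0# + s) * (1# + s)       ≈⟨ *-congʳ (recip-inverse Scalar-0) ⟩
      1# * (1# + s)                  ≈⟨ *-identityˡ _ ⟩
      1# + s                         ∎

  open CoordinateProperties m-coordinate
  module L = CoordinateProperties ℓ-coordinate

  abstract
    avoided-value : ∃ λ μ → Scalar μ × (∀ {T X} → Scalar T → X * (T + s) ≈ 1# → ¬ T - m X ≈ μ)
    avoided-value = ι (proj₁ missed) , ι-Scalar (proj₁ missed) , λ T∈P XT≈1 eq →
      let i , ιi≈T = ι-surjective T∈P in
      proj₂ missed i (ι-injective (trans (ι-g ιi≈T XT≈1) eq))
      where
      g : Fin p → Fin p
      g i = proj₁ (ι-surjective (Scalar-- (ι-Scalar i) (m∈P (recip (ι-Scalar i)))))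

      ι-g : ∀ {i T X} → ι i ≈ T → X * (T + s) ≈ 1# → ι (g i) ≈ T - m X
      ι-g {i} ιi≈T XT≈1 = trans
        (proj₂ (ι-surjective (Scalar-- (ι-Scalar i) (m∈P (recip (ι-Scalar i))))))
        (+-cong ιi≈T (-‿cong (m-cong
          (inverse-unique (recip-inverse (ι-Scalar i)) XT≈1 (+-congʳ ιi≈T)))))

      i₀ i₁ : Fin p
      i₀ = proj₁ (ι-surjective Scalar-0)
      i₁ = proj₁ (ι-surjective Scalar-1)

      ιi₀≈0 : ι i₀ ≈ 0#
      ιi₀≈0 = proj₂ (ι-surjective Scalar-0)

      ιi₁≈1 : ι i₁ ≈ 1#
      ιi₁≈1 = proj₂ (ι-surjective Scalar-1)

      i₀≢i₁ : i₀ ≢ i₁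
      i₀≢i₁ eq = 1≉0 (trans (sym ιi₁≈1) (trans (reflexive (≡.cong ι (≡.sym eq))) ιi₀≈0))

      g-collision : g i₀ ≡ g i₁
      -- The values prescribed for m at `r₀` and `r₁` were chosen so that T - m (1/(T + s)) is 0 at
      -- both T = 0 and T = 1.
      g-collision = ι-injective (begin
        ι (g i₀)    ≈⟨ ι-g ιi₀≈0 (recip-inverse Scalar-0) ⟩
        0# - m r₀   ≈⟨ +-congˡ (-‿cong m-e₀) ⟩
        0# - 0#     ≈⟨ -‿inverseʳ 0# ⟩
        0#          ≈⟨ -‿inverseʳ 1# ⟨
        1# - 1#     ≈⟨ +-congˡ (-‿cong m-e₁) ⟨
        1# - m r₁   ≈⟨ ι-g ιi₁≈1 (recip-inverse Scalar-1) ⟨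
        ι (g i₁)    ∎)

      missed : ∃ λ k → ∀ i → g i ≢ k
      missed = non-injective⇒missed-value g i₀≢i₁ g-collision

  μ : Carrier
  μ = proj₁ avoided-value

  μ∈P : Scalar μ
  μ∈P = proj₁ (proj₂ avoided-value)

  μ-avoided : ∀ {T X} → Scalar T → X * (T + s) ≈ 1# → ¬ T - m X ≈ μ
  μ-avoided = proj₂ (proj₂ avoided-value)

  σ : Carrier
  σ = μ + s

  -- The points of the two sets and the blocking property.

  graph₁ graph₂ : Fin (p ^ 3) → Triple
  graph₁ i = enum i , m (enum i) , 1#
  graph₂ i = 1# , enum i , L.m (enum i) + σ

  fibre-points₁ fibre-points₂ : Fin (p ^ 2) → Triple
  fibre-points₁ i = fibre₁ i , 1# , 0#
  fibre-points₂ i = 0# , L.fibre₁ i , 1#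

  -- The only point with a = m x = 0 is (1 : 0 : 0). It is represented with x = `r₀`, where m
  -- vanishes, so that its second coordinate is again m of the first. In the second list ℓ 1 = 0
  -- allows y = 1.
  points₁ points₂ : List Triple
  points₁ = tabulate graph₁ ++ tabulate fibre-points₁ ++ (r₀ , 0# , 0#) ∷ []
  points₂ = tabulate graph₂ ++ tabulate fibre-points₂ ++ (0# , 1# , 0#) ∷ []

  length-points : ∀ f g (P : Triple) →
    length (tabulate {n = p ^ 3} f ++ tabulate {n = p ^ 2} g ++ P ∷ []) ≡ p ^ 3 ℕ.+ (p ^ 2 ℕ.+ 1)
  length-points f g P = ≡.trans (length-++ (tabulate f)) (≡.cong₂ ℕ._+_ (length-tabulate f)
    (≡.trans (length-++ (tabulate g)) (≡.cong (ℕ._+ 1) (length-tabulate g))))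

  length-points₁ : length points₁ ≡ p ^ 3 ℕ.+ (p ^ 2 ℕ.+ 1)
  length-points₁ = length-points graph₁ fibre-points₁ (r₀ , 0# , 0#)

  length-points₂ : length points₂ ≡ p ^ 3 ℕ.+ (p ^ 2 ℕ.+ 1)
  length-points₂ = length-points graph₂ fibre-points₂ (0# , 1# , 0#)

  All-points : ∀ {q} {Q : Triple → Set q} {f : Fin (p ^ 3) → Triple} {g : Fin (p ^ 2) → Triple} {P} →
    (∀ i → Q (f i)) → (∀ i → Q (g i)) → Q P → All Q (tabulate f ++ tabulate g ++ P ∷ [])
  All-points Qf Qg QP = ++⁺ (tabulate⁺ Qf) (++⁺ (tabulate⁺ Qg) (QP ∷ []))

  points₁-nonzero : All NonZero points₁
  points₁-nonzero = All-points (λ _ (_ , _ , 1≈0) → 1≉0 1≈0)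
    (λ _ (_ , 1≈0 , _) → 1≉0 1≈0) (λ (r₀≈0 , _ , _) → recip≉0 Scalar-0 r₀≈0)

  points₂-nonzero : All NonZero points₂
  points₂-nonzero = All-points (λ _ (1≈0 , _ , _) → 1≉0 1≈0)
    (λ _ (_ , _ , 1≈0) → 1≉0 1≈0) (λ (_ , 1≈0 , _) → 1≉0 1≈0)

  points₁-block : Blocks points₁
  points₁-block (a , b , d) _ = cases (line-cases a b (- d))
    where
    cases : (∃ λ i → a * enum i + b * m (enum i) ≈ - d) ⊎ (∃ λ i → a * fibre₁ i + b ≈ 0#) ⊎ a ≈ 0# →
      ∃ λ P → P ∈ points₁ × Incident P (a , b , d)
    cases (inj₁ (i , eq)) = _ , ∈-++⁺ˡ (∈-tabulate⁺ i) ,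
      trans (+-cong eq (*-identityʳ d)) (-‿inverseˡ d)
    cases (inj₂ (inj₁ (i , eq))) = _ , ∈-++⁺ʳ (tabulate graph₁) (∈-++⁺ˡ (∈-tabulate⁺ i)) ,
      trans (solve 4 (λ a b d x → a :* x :+ b :* :1 :+ d :* :0 := a :* x :+ b)
              refl a b d (fibre₁ i)) eq
    cases (inj₂ (inj₂ a≈0)) = _ , ∈-++⁺ʳ (tabulate graph₁) (∈-++⁺ʳ (tabulate fibre-points₁) (here ≡.refl)) ,
      trans (solve 4 (λ a b d r → a :* r :+ b :* :0 :+ d :* :0 := a :* r) refl a b d r₀)
        (trans (*-congʳ a≈0) (zeroˡ r₀))

  points₂-block : Blocks points₂
  -- Substituting (1, y, ℓ y + σ) into the line equation gives b y + d ℓ y = -(a + d σ).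
  points₂-block (a , b , d) _ = cases (L.line-cases b d (- (a + d * σ)))
    where
    cases : (∃ λ i → b * enum i + d * L.m (enum i) ≈ - (a + d * σ)) ⊎
            (∃ λ i → b * L.fibre₁ i + d ≈ 0#) ⊎ b ≈ 0# →
      ∃ λ P → P ∈ points₂ × Incident P (a , b , d)
    cases (inj₁ (i , eq)) = _ , ∈-++⁺ˡ (∈-tabulate⁺ i) , (begin
      a * 1# + b * enum i + d * (L.m (enum i) + σ)
        ≈⟨ solve 6 (λ a b d x y σ →
               a :* :1 :+ b :* x :+ d :* (y :+ σ) := b :* x :+ d :* y :+ (a :+ d :* σ))
             refl a b d (enum i) (L.m (enum i)) σ ⟩
      b * enum i + d * L.m (enum i) + (a + d * σ)
        ≈⟨ +-congʳ eq ⟩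
      - (a + d * σ) + (a + d * σ)
        ≈⟨ -‿inverseˡ _ ⟩
      0#  ∎)
    cases (inj₂ (inj₁ (i , eq))) = _ , ∈-++⁺ʳ (tabulate graph₂) (∈-++⁺ˡ (∈-tabulate⁺ i)) ,
      trans (solve 4 (λ a b d x → a :* :0 :+ b :* x :+ d :* :1 := b :* x :+ d)
              refl a b d (L.fibre₁ i)) eq
    cases (inj₂ (inj₂ b≈0)) = _ , ∈-++⁺ʳ (tabulate graph₂) (∈-++⁺ʳ (tabulate fibre-points₂) (here ≡.refl)) ,
      trans (solve 3 (λ a b d → a :* :0 :+ b :* :1 :+ d :* :0 := b) refl a b d) b≈0

  -- A common description of the three kinds of points in each list, with the normalised scalar 0 or
  -- 1. It spares a comparison of nine pairs of kinds.
  Linear₁ Linear₂ : Triple → Set ℓ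
  Linear₁ (x , y , z) = y ≈ m x × (z ≈ 0# ⊎ z ≈ 1#)
  Linear₂ (x , y , z) = z ≈ L.m y + x * σ × (x ≈ 0# ⊎ x ≈ 1#)

  points₁-linear : All Linear₁ points₁
  points₁-linear = All-points (λ _ → refl , inj₂ refl) (λ i → sym (m-fibre₁ i) , inj₁ refl)
    (sym m-e₀ , inj₁ refl)

  points₂-linear : All Linear₂ points₂
  points₂-linear = All-points (λ _ → +-congˡ (sym (*-identityˡ σ)) , inj₂ refl)
    (λ i → drop-σ (L.m-fibre₁ i) , inj₁ refl) (drop-σ L.m-e₀ , inj₁ refl)
    where
    drop-σ : ∀ {y z} → L.m y ≈ z → z ≈ L.m y + 0# * σ
    drop-σ {y} ℓy≈z = trans (sym ℓy≈z) (solve 2 (λ a b → a := a :+ :0 :* b) refl (L.m y) σ)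

  ℓ-scalar : ∀ {t} → Scalar t → L.m t ≈ 0#
  ℓ-scalar {t} t∈P = begin
    L.m t         ≈⟨ L.m-cong (*-identityʳ t) ⟨
    L.m (t * 1#)  ≈⟨ L.m-* t∈P 1# ⟩
    t * L.m 1#    ≈⟨ *-congˡ L.m-e₀ ⟩
    t * 0#        ≈⟨ zeroʳ t ⟩
    0#            ∎

  ℓ-T+s : ∀ {T t} → Scalar T → t ≈ T + s → L.m t ≈ 1#
  ℓ-T+s {T} {t} T∈P t≈T+s = begin
    L.m t            ≈⟨ solve 1 (λ x → x := x :- :0) refl (L.m t) ⟩
    L.m t - 0#       ≈⟨ +-congˡ (-‿cong (ℓ-scalar T∈P)) ⟨
    L.m t - L.m T    ≈⟨ L.m-- t T ⟨
    L.m (t - T)      ≈⟨ L.m-cong (trans (+-congʳ t≈T+s) (solve 2 (λ T s → T :+ s :- T := s) refl T s)) ⟩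
    L.m s            ≈⟨ L.m-e₁ ⟩
    1#               ∎

  -- If x′ = 0, then x = 0, and the linear conditions force y′ = z′ = 0. If x′ = 1, then t z = T + s
  -- with T in P: z = 0 contradicts s ∉ P, and z = 1 contradicts the choice of μ.
  disjoint : ∀ {P Q} → Linear₁ P → Linear₂ Q → NonZero Q → ¬ Proportional P Q
  disjoint {x , y , z} {x′ , y′ , z′} (y≈mx , _) (z′≈ , inj₁ x′≈0) Q≠0 (t , t≉0 , tx , ty , _) =
    Q≠0 (x′≈0 , y′≈0 , (begin
      z′                ≈⟨ z′≈ ⟩
      L.m y′ + x′ * σ   ≈⟨ +-cong (L.m-0 y′≈0) (trans (*-congʳ x′≈0) (zeroˡ σ)) ⟩
      0# + 0#           ≈⟨ +-identityˡ 0# ⟩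
      0#                ∎))
    where
    y′≈0 : y′ ≈ 0#
    y′≈0 = begin
      y′         ≈⟨ ty ⟨
      t * y      ≈⟨ *-congˡ (trans y≈mx (m-0 (*-cancel-0 t≉0 (trans tx x′≈0)))) ⟩
      t * 0#     ≈⟨ zeroʳ t ⟩
      0#         ∎
  disjoint {x , y , z} {x′ , y′ , z′} (y≈mx , z∈01) (z′≈ , inj₂ x′≈1) Q≠0 (t , t≉0 , tx , ty , tz) =
    [ contradiction-0 , contradiction-1 ]′ z∈01
    where
    -- Since y′ = t m x and m x is a scalar, ℓ y′ = m x ℓ t. Adding μ gives the scalar part of z′ =
    -- ℓ y′ + μ + s.
    T : Carrier
    T = m x * L.m t + μ

    T∈P : Scalar T
    T∈P = Scalar-+ (Scalar-* (m∈P x) (L.m∈P t)) μ∈P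

    ℓy′≈ : L.m y′ ≈ m x * L.m t
    ℓy′≈ = begin
      L.m y′         ≈⟨ L.m-cong (trans (sym ty) (trans (*-comm t y) (*-congʳ y≈mx))) ⟩
      L.m (m x * t)  ≈⟨ L.m-* (m∈P x) t ⟩
      m x * L.m t    ∎

    tz≈T+s : t * z ≈ T + s
    tz≈T+s = begin
      t * z                       ≈⟨ tz ⟩
      z′                          ≈⟨ z′≈ ⟩
      L.m y′ + x′ * σ             ≈⟨ +-cong ℓy′≈ (trans (*-congʳ x′≈1) (*-identityˡ σ)) ⟩
      m x * L.m t + (μ + s)       ≈⟨ +-assoc _ _ _ ⟨
      T + s                       ∎

    contradiction-0 : ¬ z ≈ 0#
    contradiction-0 z≈0 = T+s≉0 T∈P (trans (sym tz≈T+s) (trans (*-congˡ z≈0) (zeroʳ t)))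

    contradiction-1 : ¬ z ≈ 1#
    -- Now t = T + s, so x (T + s) = 1 and ℓ t = 1. Hence T = m x + μ, the excluded equation.
    contradiction-1 z≈1 = μ-avoided T∈P
      (trans (*-congˡ (sym t≈T+s)) (trans (*-comm x t) (trans tx x′≈1)))
      (begin
        m x * L.m t + μ - m x   ≈⟨ +-congʳ (+-congʳ (*-congˡ (ℓ-T+s T∈P t≈T+s))) ⟩
        m x * 1# + μ - m x      ≈⟨ solve 2 (λ a μ → a :* :1 :+ μ :- a := μ) refl (m x) μ ⟩
        μ                       ∎)
      where
      t≈T+s : t ≈ T + s
      t≈T+s = trans (sym (*-identityʳ t)) (trans (*-congˡ (sym z≈1)) tz≈T+s)

  -- Each list is shorter by p than half of the required size.
  length-points≤ : length points₁ ℕ.+ length points₂ ≤ 2 ℕ.* (p ^ 3 ℕ.+ p ^ 2 ℕ.+ p ℕ.+ 1)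
  length-points≤ = ≡.subst₂ (λ a b → a ℕ.+ b ≤ 2 ℕ.* n) (≡.sym length-points₁) (≡.sym length-points₂)
    (ℕ.≤-trans (ℕ.+-mono-≤ p³+p²+1≤n p³+p²+1≤n)
               (ℕ.≤-reflexive (≡.cong (n ℕ.+_) (≡.sym (ℕ.+-identityʳ n)))))
    where
    n : ℕ
    n = p ^ 3 ℕ.+ p ^ 2 ℕ.+ p ℕ.+ 1
    p³+p²+1≤n : p ^ 3 ℕ.+ (p ^ 2 ℕ.+ 1) ≤ n
    p³+p²+1≤n = ≡.subst (_≤ n) (ℕ.+-assoc (p ^ 3) (p ^ 2) 1)
      (ℕ.+-monoˡ-≤ 1 (ℕ.m≤m+n (p ^ 3 ℕ.+ p ^ 2) p))

open import Data.Nat using (_+_; _*_)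

theorem4 : ∀ {c ℓ : Level} (p : ℕ) → Prime p → p ≤ 73 →
    (F : CommutativeRing c ℓ) → IsField F → HasOrder F (p ^ 3) →
    Σ (ProjectivePlane.PointSet F (2 * (p ^ 3 + p ^ 2 + p + 1))) λ B →
    ProjectivePlane.Is2FoldBlocking F B
theorem4 p p-prime _ F isField order =
  disjoint-blocking⇒2-fold points₁-nonzero points₂-nonzero
    length-points≤ (2[p³+p²+p+1]≤p⁶ 1<p)
    (λ P∈ Q∈ → disjoint (All.lookup points₁-linear P∈) (All.lookup points₂-linear Q∈)
                        (All.lookup points₂-nonzero Q∈))
    points₁-block points₂-block
  where
  open CubicExtension F isField p-prime order using (1<p)
  open PointSets F isField order using (disjoint-blocking⇒2-fold)
  open DisjointBlockingSets F isField p-prime order
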